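{- Let $\mathscr{Y}$ be a mixed graph that is a $\gamma$-monograph and such that $\Gamma(\mathscr{Y})=L(\mathscr{T})$ for some tree $\mathscr{T}$. Then $\mathscr{Y}=L_\gamma(\mathscr{X})$ for some mixed graph $\mathscr{X}$ with $\Gamma(\mathscr{X})=\mathscr{T}$.
   Context: $\gamma=e^{2\pi i/3}$. A mixed graph is obtained from a finite simple undirected graph by orienting some (possibly none or all) of its edges into arcs; the unoriented edges are called digons. $\Gamma(\mathscr{D})$ denotes the underlying undirected graph of $\mathscr{D}$; a mixed orientation of an undirected graph $\mathscr{G}$ is a mixed graph with underlying graph $\mathscr{G}$. $L(\mathscr{G})$ is the ordinary undirected line graph. $\gamma$-Hermitian adjacency matrix $H=H_\gamma(\mathscr{D})$: the entry at $(u,v)$ is $1$ if $uv$ is a digon, $\gamma$ if there is an arc from $u$ to $v$, $\overline\gamma$ if there is an arc from $v$ to $u$, and $0$ otherwise. The value of a walk $W=v_1v_2\ldots v_k$ (a walk in $\Gamma(\mathscr{D})$) is $h_\gamma(W)=H_{v_1,v_2}H_{v_2,v_3}\cdots H_{v_{k-1},v_k}$. $\mathscr{D}$ is a $\gamma$-monograph if $h_\gamma(\vec C)=1$ for every cycle $C$ of $\Gamma(\mathscr{D})$, where $\vec C$ is an arbitrary closed traversal walk on $C$. $\gamma$-line graph $L_\gamma(\mathscr{D})$: the mixed orientation of $L(\Gamma(\mathscr{D}))$ given as follows. For distinct edges $e,f$ sharing a vertex $v$: if $e$ is an arc with head $v$ and $f$ is an arc with tail $v$, there is an arc from $e$ to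 $f$; if $e,f$ are both arcs with head $v$, or both arcs with tail $v$, or both digons, then $ef$ is a digon; if $e$ is an arc with head $v$ and $f$ is a digon, there is an arc from $f$ to $e$; if $e$ is an arc with tail $v$ and $f$ is a digon, there is an arc from $e$ to $f$. -}

module Defs where

open import Level using (0ℓ)
open import Data.Bool.Base using (if_then_else_)
open import Data.Nat.Base using (ℕ; NonZero)
import Data.Nat.Base as ℕ
open import Data.Integer.Base using (ℤ; 0ℤ; 1ℤ; -1ℤ; _+_; _-_)
import Data.Integer.Base as ℤ
open import Data.Fin.Base using (Fin; zero; suc; _<_)
open import Data.Fin.Properties using (_≟_; _<?_; any?; <-asym)
open import Data.List.Base
  using (List; []; _∷_; _∷ʳ_; length; lookup; filter; allFin; cartesianProduct)
open import Data.List.Membership.Propositional.Properties using (∈-lookup; ∈-filter⁻)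
open import Data.List.Relation.Unary.AllPairs using (_∷_)
import Data.List.Relation.Unary.All as All
open import Data.List.Relation.Unary.Linked using (Linked)
open import Data.List.Relation.Unary.Unique.Propositional using (Unique)
open import Data.List.Relation.Unary.Unique.Propositional.Properties
  using (filter⁺; cartesianProduct⁺; allFin⁺)
open import Data.Product.Base using (_×_; _,_; proj₁; proj₂; ∃-syntax)
open import Data.Product.Properties using (,-injectiveˡ; ,-injectiveʳ; ≡-dec)
open import Data.Sum.Base using (_⊎_; inj₁; inj₂)
open import Data.Empty using (⊥; ⊥-elim)
open import Function.Bundles using (_↔_; _⇔_; Inverse)
open import Relation.Binary.Core using (Rel)
open import Relation.Binary.Definitions
  using (Decidable; Symmetric; Irreflexive; Asymmetric)
open import Relation.Binary.Construct.Closure.ReflexiveTransitive using (Star)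
open import Relation.Binary.PropositionalEquality
  using (_≡_; _≢_; refl; sym; trans; cong; subst)
open import Relation.Nullary using (¬_; Dec; yes; no; does; ¬?; _×-dec_; _⊎-dec_)
import Relation.Unary as U

lookup-injective : ∀ {A : Set} {xs : List A} → Unique xs →
                   ∀ i j → lookup xs i ≡ lookup xs j → i ≡ j
lookup-injective (_  ∷ _) zero    zero    _  = refl
lookup-injective (px ∷ _) zero    (suc j) eq =
  ⊥-elim (All.lookup px (∈-lookup j) eq)
lookup-injective (px ∷ _) (suc i) zero    eq =
  ⊥-elim (All.lookup px (∈-lookup i) (sym eq))
lookup-injective (_  ∷ u) (suc i) (suc j) eq =
  cong suc (lookup-injective u i j eq)

record Graph : Set₁ where
  infix 4 _~_ _~?_
  field
    order    : ℕ
  Vertex : Set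
  Vertex = Fin order
  field
    _~_      : Rel Vertex 0ℓ
    _~?_     : Decidable _~_
    ~-sym    : Symmetric _~_
    ~-irrefl : Irreflexive _≡_ _~_

  -- A cycle, given by its vertices in the order of a traversal, starting
  -- at v; the closed traversal walk is (v ∷ vs) ∷ʳ v.
  record IsCycle (v : Vertex) (vs : List Vertex) : Set where
    field
      long     : 3 ℕ.≤ length (v ∷ vs)
      distinct : Unique (v ∷ vs)
      walk     : Linked _~_ ((v ∷ vs) ∷ʳ v)

  record IsTree : Set where
    field
      nonempty  : NonZero order
      connected : ∀ u v → Star _~_ u v
      acyclic   : ∀ v vs → ¬ IsCycle v vs

  -- Each edge is listed once, as the pair of its ends in increasing order;
  -- an edge is then a position in this list.
  isEdge? : U.Decidable (λ ((u , v) : Vertex × Vertex) → u < v × u ~ v)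
  isEdge? (u , v) = u <? v ×-dec u ~? v

  edges : List (Vertex × Vertex)
  edges = filter isEdge? (cartesianProduct (allFin order) (allFin order))

  size : ℕ
  size = length edges

  Edge : Set
  Edge = Fin size

  ends : Edge → Vertex × Vertex
  ends = lookup edges

  _Joins_,_ : Edge → Vertex → Vertex → Set
  e Joins u , v = ends e ≡ (u , v) ⊎ ends e ≡ (v , u)

  joins? : ∀ e u v → Dec (e Joins u , v)
  joins? e u v = ends e ≟₂ (u , v) ⊎-dec ends e ≟₂ (v , u)
    where _≟₂_ = ≡-dec _≟_ _≟_

  _∈ᵉ_ : Vertex → Edge → Set
  v ∈ᵉ e = ∃[ u ] e Joins u , v

  _∈ᵉ?_ : ∀ v e → Dec (v ∈ᵉ e)
  v ∈ᵉ? e = any? λ u → joins? e u v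

  ends-injective : ∀ {e f} → ends e ≡ ends f → e ≡ f
  ends-injective {e} {f} = lookup-injective
    (filter⁺ isEdge? (cartesianProduct⁺ (allFin⁺ order) (allFin⁺ order))) e f

  ends-< : ∀ e → proj₁ (ends e) < proj₂ (ends e)
  ends-< e = proj₁ (proj₂ (∈-filter⁻ isEdge?
    {xs = cartesianProduct (allFin order) (allFin order)} (∈-lookup e)))

  Joins-unique : ∀ {e u u′ v} → e Joins u , v → e Joins u′ , v → u ≡ u′
  Joins-unique (inj₁ p) (inj₁ q) = ,-injectiveˡ (trans (sym p) q)
  Joins-unique (inj₁ p) (inj₂ q) =
    let r = trans (sym p) q in trans (,-injectiveˡ r) (,-injectiveʳ r)
  Joins-unique (inj₂ p) (inj₁ q) =
    let r = trans (sym p) q in trans (,-injectiveʳ r) (,-injectiveˡ r)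
  Joins-unique (inj₂ p) (inj₂ q) = ,-injectiveʳ (trans (sym p) q)

  Joins-injective : ∀ {e f u v} → e Joins u , v → f Joins u , v → e ≡ f
  Joins-injective (inj₁ p) (inj₁ q) = ends-injective (trans p (sym q))
  Joins-injective (inj₂ p) (inj₂ q) = ends-injective (trans p (sym q))
  Joins-injective {e} {f} (inj₁ p) (inj₂ q) =
    ⊥-elim (<-asym (subst (λ (a , b) → a < b) p (ends-< e))
                   (subst (λ (a , b) → a < b) q (ends-< f)))
  Joins-injective {e} {f} (inj₂ p) (inj₁ q) =
    ⊥-elim (<-asym (subst (λ (a , b) → a < b) p (ends-< e))
                   (subst (λ (a , b) → a < b) q (ends-< f)))

  ∈ᵉ-joins : ∀ {e v w} → v ≢ w → v ∈ᵉ e → w ∈ᵉ e → e Joins v , w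
  ∈ᵉ-joins v≢w (_ , inj₁ p) (_ , inj₁ q) =
    ⊥-elim (v≢w (,-injectiveʳ (trans (sym p) q)))
  ∈ᵉ-joins v≢w (_ , inj₂ p) (_ , inj₂ q) =
    ⊥-elim (v≢w (,-injectiveˡ (trans (sym p) q)))
  ∈ᵉ-joins v≢w (_ , inj₁ p) (_ , inj₂ q) with refl ← trans (sym p) q = inj₂ p
  ∈ᵉ-joins v≢w (_ , inj₂ p) (_ , inj₁ q) with refl ← trans (sym p) q = inj₁ p

  common-vertex-unique : ∀ {e f v w} → e ≢ f → v ∈ᵉ e → v ∈ᵉ f →
                         w ∈ᵉ e → w ∈ᵉ f → v ≡ w
  common-vertex-unique {v = v} {w} e≢f ve vf we wf with v ≟ w
  ... | yes v≡w = v≡w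
  ... | no  v≢w =
    ⊥-elim (e≢f (Joins-injective (∈ᵉ-joins v≢w ve we) (∈ᵉ-joins v≢w vf wf)))

record _≅_ (G G′ : Graph) : Set where
  private
    module G  = Graph G
    module G′ = Graph G′
  field
    bijection : G.Vertex ↔ G′.Vertex
  to : G.Vertex → G′.Vertex
  to = Inverse.to bijection
  field
    adjacency : ∀ u v → u G.~ v ⇔ to u G′.~ to v

lineGraph : Graph → Graph
lineGraph G = record
  { order    = size
  ; _~_      = λ e f → e ≢ f × ∃[ v ] (v ∈ᵉ e × v ∈ᵉ f)
  ; _~?_     = λ e f → ¬? (e ≟ f) ×-dec any? λ v → (v ∈ᵉ? e) ×-dec (v ∈ᵉ? f)
  ; ~-sym    = λ (e≢f , v , ve , vf) → (λ f≡e → e≢f (sym f≡e)) , v , vf , ve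
  ; ~-irrefl = λ e≡f (e≢f , _) → e≢f e≡f
  }
  where open Graph G

record MixedOrientation (G : Graph) : Set₁ where
  open Graph G
  field
    Arc      : Rel Vertex 0ℓ
    Arc?     : Decidable Arc
    Arc⇒~    : ∀ {u v} → Arc u v → u ~ v
    Arc-asym : Asymmetric Arc

  Digon : Rel Vertex 0ℓ
  Digon u v = u ~ v × ¬ Arc u v × ¬ Arc v u

  Digon? : Decidable Digon
  Digon? u v = u ~? v ×-dec ¬? (Arc? u v) ×-dec ¬? (Arc? v u)

  HeadAt TailAt DigonAt : Edge → Vertex → Set
  HeadAt  e v = ∃[ u ] (e Joins u , v × Arc u v)
  TailAt  e v = ∃[ u ] (e Joins u , v × Arc v u)
  DigonAt e v = ∃[ u ] (e Joins u , v × Digon u v)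

  HeadAt? : ∀ e v → Dec (HeadAt e v)
  HeadAt? e v = any? λ u → joins? e u v ×-dec Arc? u v

  TailAt? : ∀ e v → Dec (TailAt e v)
  TailAt? e v = any? λ u → joins? e u v ×-dec Arc? v u

  DigonAt? : ∀ e v → Dec (DigonAt e v)
  DigonAt? e v = any? λ u → joins? e u v ×-dec Digon? u v

  ¬Head×Tail : ∀ {e v} → HeadAt e v → TailAt e v → ⊥
  ¬Head×Tail (_ , j , a) (_ , k , b) with refl ← Joins-unique j k = Arc-asym a b

  ¬Head×Digon : ∀ {e v} → HeadAt e v → DigonAt e v → ⊥
  ¬Head×Digon (_ , j , a) (_ , k , _ , na , _) with refl ← Joins-unique j k = na a

  ¬Tail×Digon : ∀ {e v} → TailAt e v → DigonAt e v → ⊥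
  ¬Tail×Digon (_ , j , a) (_ , k , _ , _ , na) with refl ← Joins-unique j k = na a

  LineArcAt : Vertex → Edge → Edge → Set
  LineArcAt v e f = (HeadAt  e v × TailAt  f v)
                  ⊎ (DigonAt e v × HeadAt  f v)
                  ⊎ (TailAt  e v × DigonAt f v)

  LineArcAt? : ∀ v e f → Dec (LineArcAt v e f)
  LineArcAt? v e f = (HeadAt?  e v ×-dec TailAt?  f v)
               ⊎-dec (DigonAt? e v ×-dec HeadAt?  f v)
               ⊎-dec (TailAt?  e v ×-dec DigonAt? f v)

  LineArcAt⇒∈ : ∀ {v e f} → LineArcAt v e f → v ∈ᵉ e × v ∈ᵉ f
  LineArcAt⇒∈ (inj₁        ((u , j , _) , (w , k , _)))  = (u , j) , (w , k)
  LineArcAt⇒∈ (inj₂ (inj₁  ((u , j , _) , (w , k , _)))) = (u , j) , (w , k)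
  LineArcAt⇒∈ (inj₂ (inj₂  ((u , j , _) , (w , k , _)))) = (u , j) , (w , k)

  LineArcAt-asym : ∀ {v e f} → LineArcAt v e f → LineArcAt v f e → ⊥
  LineArcAt-asym (inj₁ (h , t)) (inj₁ (h′ , t′))               = ¬Head×Tail h t′
  LineArcAt-asym (inj₁ (h , t)) (inj₂ (inj₁ (d , h′)))         = ¬Tail×Digon t d
  LineArcAt-asym (inj₁ (h , t)) (inj₂ (inj₂ (t′ , d)))         = ¬Head×Digon h d
  LineArcAt-asym (inj₂ (inj₁ (d , h))) (inj₁ (h′ , t))         = ¬Tail×Digon t d
  LineArcAt-asym (inj₂ (inj₁ (d , h))) (inj₂ (inj₁ (d′ , h′))) = ¬Head×Digon h d′
  LineArcAt-asym (inj₂ (inj₁ (d , h))) (inj₂ (inj₂ (t , d′)))  = ¬Head×Tail h t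
  LineArcAt-asym (inj₂ (inj₂ (t , d))) (inj₁ (h , t′))         = ¬Head×Digon h d
  LineArcAt-asym (inj₂ (inj₂ (t , d))) (inj₂ (inj₁ (d′ , h)))  = ¬Head×Tail h t
  LineArcAt-asym (inj₂ (inj₂ (t , d))) (inj₂ (inj₂ (t′ , d′))) = ¬Tail×Digon t d′

-- Adjacent edges that are both arcs with head v, both arcs with tail v, or
-- both digons get no arc in either direction, so they form a digon.
lineγ : ∀ {G} → MixedOrientation G → MixedOrientation (lineGraph G)
lineγ {G} X = record
  { Arc      = λ e f → e ≢ f × ∃[ v ] LineArcAt v e f
  ; Arc?     = λ e f → ¬? (e ≟ f) ×-dec any? λ v → LineArcAt? v e f
  ; Arc⇒~    = λ (e≢f , v , a) → e≢f , v , LineArcAt⇒∈ a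
  ; Arc-asym = asym
  }
  where
  open Graph G
  open MixedOrientation X
  asym : Asymmetric (λ e f → e ≢ f × ∃[ v ] LineArcAt v e f)
  asym (e≢f , v , a) (_ , w , b)
    with ve , vf ← LineArcAt⇒∈ a | wf , we ← LineArcAt⇒∈ b
    with refl ← common-vertex-unique e≢f ve vf we wf = LineArcAt-asym a b

-- Preservation of arcs suffices: φ preserves adjacency, hence also digons.
EqualAlong : ∀ {G G′} → G ≅ G′ → MixedOrientation G → MixedOrientation G′ → Set
EqualAlong φ Y Y′ =
  ∀ u v → Y.Arc u v ⇔ Y′.Arc (_≅_.to φ u) (_≅_.to φ v)
  where
  module Y  = MixedOrientation Y
  module Y′ = MixedOrientation Y′

-- The subring ℤ[γ] of ℂ, where γ = e^{2πi/3}: ⟨ a , b ⟩ is a + bγ.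
record ℤ[γ] : Set where
  constructor ⟨_,_⟩
  field
    coeff₁ coeffγ : ℤ

0# 1# γ γ̄ : ℤ[γ]
0# = ⟨ 0ℤ , 0ℤ ⟩
1# = ⟨ 1ℤ , 0ℤ ⟩
γ  = ⟨ 0ℤ , 1ℤ ⟩
γ̄  = ⟨ -1ℤ , -1ℤ ⟩

-- γ² = γ̄ = -1 - γ
infixl 7 _*_
_*_ : ℤ[γ] → ℤ[γ] → ℤ[γ]
⟨ a , b ⟩ * ⟨ c , d ⟩ = ⟨ a ℤ.* c - b ℤ.* d , a ℤ.* d + b ℤ.* c - b ℤ.* d ⟩

module _ {G : Graph} (D : MixedOrientation G) where
  open Graph G using (Vertex; IsCycle)
  open MixedOrientation D

  H : Vertex → Vertex → ℤ[γ]
  H u v = if does (Digon? u v) then 1#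
          else if does (Arc? u v) then γ
          else if does (Arc? v u) then γ̄
          else 0#

  walkValue : List (Vertex) → ℤ[γ]
  walkValue []           = 1#
  walkValue (v ∷ [])     = 1#
  walkValue (u ∷ v ∷ vs) = H u v * walkValue (v ∷ vs)

  IsMonograph : Set
  IsMonograph = ∀ v vs → IsCycle v vs → walkValue ((v ∷ vs) ∷ʳ v) ≡ 1#

-- Encode digon, arc and reversed arc by 0, 1, 2 ∈ ℤ/3. Being a monograph
-- makes the gains of 𝒴 additive around each triangle of L(𝒯) coming from
-- three edges at a common vertex. If t u v is the code of the edge uv read
-- towards v, then 𝒴 = L_γ(𝒳) says exactly that t is antisymmetric and
-- t w v − t u v is the gain from uv to wv. Such a t is built by growing 𝒯 one
-- leaf at a time: at each step the label of the new edge is forced by any one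
-- of the old edges at its old end, and additivity makes it agree with the others.

module Submission where

open import Defs
open import Algebra.Bundles using (Group)
import Algebra.Properties.Group as GroupProperties
open import Data.Bool.Base using (if_then_else_)
open import Data.Empty using (⊥-elim)
open import Data.Fin.Base using (Fin; toℕ; fromℕ<)
open import Data.Fin.Patterns using (0F; 1F; 2F)
open import Data.Fin.Properties using (_≟_; any?; all?; <-cmp)
open import Data.List.Base using (List; []; _∷_; _∷ʳ_; allFin; cartesianProduct; length)
open import Data.List.Membership.Propositional using (_∈_; _∉_)
open import Data.List.Membership.Propositional.Properties
  using (∈-filter⁺; ∈-filter⁻; ∈-lookup; ∈-allFin; ∈-cartesianProduct⁺)
open import Data.List.Relation.Binary.Subset.Propositional using (_⊆_)
open import Data.List.Relation.Unary.All as All using (All; []; _∷_)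
import Data.List.Relation.Unary.All.Properties as Allₚ
open import Data.List.Relation.Unary.AllPairs using ([]; _∷_)
import Data.List.Relation.Unary.AllPairs.Properties as AllPairsₚ
open import Data.List.Relation.Unary.Any using (here; there)
open import Data.List.Relation.Unary.Any.Properties using (lookup-index)
open import Data.List.Relation.Unary.Linked using (Linked; [-]; _∷_)
open import Data.List.Relation.Unary.Unique.Propositional using (Unique)
import Data.Integer.Base as ℤ
open import Data.Nat.Base using (s≤s; z≤n)
import Data.Nat.Base as ℕ
open import Data.Nat.DivMod using (_mod_)
open import Data.Product using (Σ-syntax; ∃-syntax; _×_; _,_; proj₁; proj₂; uncurry)
open import Data.Sum.Base using (inj₁; inj₂)
open import Function.Base using (_∘_; id)
open import Function.Bundles using (Equivalence; Inverse; mk⇔)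
open import Level using (0ℓ)
open import Relation.Binary.Construct.Closure.ReflexiveTransitive using (Star; ε; _◅_)
open import Relation.Binary.Definitions using (tri<; tri≈; tri>)
open import Relation.Binary.PropositionalEquality
  using (_≡_; _≢_; refl; sym; trans; cong; cong₂; subst; subst₂; isEquivalence;
         module ≡-Reasoning)
open import Relation.Nullary using (¬_; does; yes; no; contradiction)
open import Relation.Nullary.Decidable using (toWitness; _×-dec_; dec-true; _→-dec_)

-- Edges as list positions and adjacency.

module Edges (G : Graph) where
  open Graph G

  Joins⇒~ : ∀ {e u v} → e Joins u , v → u ~ v
  Joins⇒~ {e} = λ where
      (inj₁ p) → subst (uncurry _~_) p ends-~
      (inj₂ p) → ~-sym (subst (uncurry _~_) p ends-~)
    where
    ends-~ : uncurry _~_ (ends e)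
    ends-~ = proj₂ (proj₂ (∈-filter⁻ isEdge?
      {xs = cartesianProduct (allFin order) (allFin order)} (∈-lookup e)))

  ~⇒Joins : ∀ {u v} → u ~ v → ∃[ e ] e Joins u , v
  ~⇒Joins {u} {v} u~v with <-cmp u v
  ... | tri< u<v _ _ = _ , inj₁ (sym (lookup-index (∈-filter⁺ isEdge?
          (∈-cartesianProduct⁺ (∈-allFin u) (∈-allFin v)) (u<v , u~v))))
  ... | tri≈ _ u≡v _ = contradiction u~v (~-irrefl u≡v)
  ... | tri> _ _ v<u = _ , inj₂ (sym (lookup-index (∈-filter⁺ isEdge?
          (∈-cartesianProduct⁺ (∈-allFin v) (∈-allFin u)) (v<u , ~-sym u~v))))

-- Growing a tree one leaf at a time.

module Growth (G : Graph) (acyclic : ∀ v vs → ¬ Graph.IsCycle G v vs) where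
  open Graph G
  open import Data.List.Membership.DecPropositional (_≟_ {order}) using (_∈?_)

  data Path : Vertex → Vertex → List Vertex → Set where
    [_] : ∀ v → Path v v (v ∷ [])
    _∷_ : ∀ {u v w vs} → u ~ v → Path v w vs → Path u w (u ∷ vs)

  snoc : ∀ {u v w vs} → Path u v vs → v ~ w → Path u w (vs ∷ʳ w)
  snoc [ _ ]   v~w = v~w ∷ [ _ ]
  snoc (a ∷ p) v~w = a ∷ snoc p v~w

  linked : ∀ {u v w x vs} → w ~ u → Path u v vs → v ~ x → Linked _~_ ((w ∷ vs) ∷ʳ x)
  linked w~u [ _ ]   v~x = w~u ∷ v~x ∷ [-]
  linked w~u (a ∷ p) v~x = w~u ∷ linked a p v~x

  Path-length : ∀ {u v vs} → u ≢ v → Path u v vs → 2 ℕ.≤ length vs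
  Path-length u≢v [ _ ]         = contradiction refl u≢v
  Path-length u≢v (_ ∷ [ _ ])   = s≤s (s≤s z≤n)
  Path-length u≢v (_ ∷ (_ ∷ _)) = s≤s (s≤s z≤n)

  SimplePathIn : List Vertex → Vertex → Vertex → Set
  SimplePathIn S u v = ∃[ vs ] Path u v vs × Unique vs × All (_∈ S) vs

  -- `leaf` names one neighbour of `v` in `S` and does not itself forbid others; acyclicity excludes
  -- them in `leaf-neighbour`.
  data Grown : List Vertex → Set where
    root : ∀ r → Grown (r ∷ [])
    leaf : ∀ {S u v} → Grown S → u ∈ S → v ∉ S → u ~ v → Grown (v ∷ S)

  ∉⇒All≢ : ∀ {S vs} {v : Vertex} → v ∉ S → All (_∈ S) vs → All (v ≢_) vs
  ∉⇒All≢ v∉S = All.map λ x∈S v≡x → v∉S (subst (_∈ _) (sym v≡x) x∈S)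

  -- A path to or from the newest vertex goes through the vertex it was attached to, and stays
  -- simple because the newest vertex lies outside the older list. Simplicity and containment in `S`
  -- are what later turn such a path into a cycle.
  Grown-connected : ∀ {S} → Grown S → ∀ {x y} → x ∈ S → y ∈ S → SimplePathIn S x y
  Grown-connected (root r) (here refl) (here refl) =
    _ , [ r ] , [] ∷ [] , here refl ∷ []
  Grown-connected (leaf {v = v} g u∈S v∉S u~v) (here refl) (here refl) =
    _ , [ v ] , [] ∷ [] , here refl ∷ []
  Grown-connected (leaf g u∈S v∉S u~v) (here refl) (there y∈S)
    with vs , p , vs! , vs⊆S ← Grown-connected g u∈S y∈S =
    _ , ~-sym u~v ∷ p , ∉⇒All≢ v∉S vs⊆S ∷ vs! , here refl ∷ All.map there vs⊆S
  Grown-connected (leaf g u∈S v∉S u~v) (there x∈S) (here refl)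
    with vs , p , vs! , vs⊆S ← Grown-connected g x∈S u∈S =
    _ , snoc p u~v
      , AllPairsₚ.++⁺ vs! ([] ∷ []) (All.map (λ v≢x → (v≢x ∘ sym) ∷ []) (∉⇒All≢ v∉S vs⊆S))
      , Allₚ.∷ʳ⁺ (All.map there vs⊆S) (here refl)
  Grown-connected (leaf g u∈S v∉S u~v) (there x∈S) (there y∈S)
    with vs , p , vs! , vs⊆S ← Grown-connected g x∈S y∈S =
    _ , p , vs! , All.map there vs⊆S

  -- A second neighbour `w` would close the simple path from `w` to `u` inside `S` into a cycle
  -- through `v`.
  leaf-neighbour : ∀ {S u v w} → Grown S → v ∉ S → u ∈ S → u ~ v → w ∈ S → w ~ v → w ≡ u
  leaf-neighbour {u = u} {v} {w} g v∉S u∈S u~v w∈S w~v with w ≟ u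
  ... | yes w≡u = w≡u
  ... | no  w≢u with vs , p , vs! , vs⊆S ← Grown-connected g w∈S u∈S =
    ⊥-elim (acyclic v vs record
      { long     = s≤s (Path-length w≢u p)
      ; distinct = ∉⇒All≢ v∉S vs⊆S ∷ vs!
      ; walk     = linked (~-sym w~v) p u~v
      })

  -- Each vertex of the walk not yet in the list is attached to its predecessor on the walk, which
  -- already is.
  grow-along : ∀ {S u v} → Grown S → u ∈ S → Star _~_ u v →
               ∃[ S′ ] Grown S′ × S ⊆ S′ × v ∈ S′
  grow-along g u∈S ε = _ , g , id , u∈S
  grow-along {S} g u∈S (_◅_ {j = w} u~w p) with w ∈? S
  ... | yes w∈S = grow-along g w∈S p
  ... | no  w∉S with S′ , g′ , S⊆S′ , v∈S′ ← grow-along (leaf g u∈S w∉S u~w) (here refl) p =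
    S′ , g′ , S⊆S′ ∘ there , v∈S′

  grow-over : (∀ u v → Star _~_ u v) → ∀ {S r} → Grown S → r ∈ S → ∀ vs →
              ∃[ S′ ] Grown S′ × S ⊆ S′ × All (_∈ S′) vs
  grow-over conn g r∈S [] = _ , g , id , []
  grow-over conn g r∈S (v ∷ vs)
    with S₁ , g₁ , S⊆S₁ , v∈S₁ ← grow-along g r∈S (conn _ v)
    with S₂ , g₂ , S₁⊆S₂ , vs⊆S₂ ← grow-over conn g₁ (S⊆S₁ r∈S) vs =
    S₂ , g₂ , S₁⊆S₂ ∘ S⊆S₁ , S₁⊆S₂ v∈S₁ ∷ vs⊆S₂

  spanning-growth : Vertex → (∀ u v → Star _~_ u v) → ∃[ S ] Grown S × (∀ v → v ∈ S)
  spanning-growth r conn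
    with S , g , _ , all∈S ← grow-over conn (root r) (here refl) (allFin order) =
    S , g , λ v → All.lookup all∈S (∈-allFin v)

-- Antisymmetric labellings with prescribed differences between edges at a common vertex.

module Labelling
  (A : Group 0ℓ 0ℓ) (T : Graph) (acyclic : ∀ v vs → ¬ Graph.IsCycle T v vs)
  (s : Graph.Edge T → Graph.Edge T → Group.Carrier A)
  (s-refl : ∀ e → Group._≈_ A (s e e) (Group.ε A))
  (s-add : ∀ {v} e f g → Graph._∈ᵉ_ T v e → Graph._∈ᵉ_ T v f → Graph._∈ᵉ_ T v g →
           Group._≈_ A (s e g) (Group._∙_ A (s e f) (s f g)))
  where
  open Graph T
  open Edges T
  open Growth T acyclic
  open Group A renaming
    ( refl to ≈-refl; sym to ≈-sym; trans to ≈-trans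
    ; _∙_ to _+_; ε to 0ᴬ; _⁻¹ to -_ )
  open GroupProperties A using (⁻¹-involutive; ε⁻¹≈ε)
  open import Relation.Binary.Reasoning.Setoid setoid
  open import Data.List.Membership.DecPropositional (_≟_ {order}) using (_∈?_)

  -- t u v is the label of the edge uv read towards v.
  record IsLabelling (S : List Vertex) (t : Vertex → Vertex → Carrier) : Set where
    field
      antisym    : ∀ u v → t v u ≈ - t u v
      consistent : ∀ {u v w e f} → u ∈ S → v ∈ S → w ∈ S →
                   e Joins u , v → f Joins w , v → t w v ≈ t u v + s e f

  -- Additivity along `e`, `f`, `e` gives `s e f + s f e = s e e = 0`.
  s-flip : ∀ {e f v} x y → v ∈ᵉ e → v ∈ᵉ f → y ≈ x + s e f → x ≈ y + s f e
  s-flip {e} {f} x y ve vf eq = ≈-sym (begin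
    y + s f e              ≈⟨ ∙-congʳ eq ⟩
    (x + s e f) + s f e    ≈⟨ assoc x (s e f) (s f e) ⟩
    x + (s e f + s f e)    ≈⟨ ∙-congˡ (s-add e f e ve vf ve) ⟨
    x + s e e              ≈⟨ ∙-congˡ (s-refl e) ⟩
    x + 0ᴬ                 ≈⟨ identityʳ x ⟩
    x                      ∎)

  label-consistent-refl : ∀ {e f u v w} (t : Vertex → Vertex → Carrier) → u ≡ w →
                          e Joins u , v → f Joins w , v → t w v ≈ t u v + s e f
  label-consistent-refl {e} t refl j k with refl ← Joins-injective j k =
    ≈-sym (≈-trans (∙-congˡ (s-refl e)) (identityʳ _))

  module Extend {S u v t} (g : Grown S) (u∈S : u ∈ S) (v∉S : v ∉ S) (u~v : u ~ v)
                (t-lab : IsLabelling S t) where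
    open IsLabelling t-lab

    -- `c` will label the new edge read from `v` towards its old end `u`. It is computed from one
    -- old edge at `u`; any other gives the same value, since `consistent` relates the two old
    -- labels and `s-add` composes the differences.
    label-new : ∃[ c ] ∀ {x e f} → x ∈ S → e Joins x , u → f Joins v , u → c ≈ t x u + s e f
    label-new with any? (λ x → (x ∈? S) ×-dec (x ~? u))
    -- No edge inside `S` meets `u`, so the new label is unconstrained and zero is an arbitrary
    -- choice.
    ... | no  none = 0ᴬ , λ x∈S j _ → contradiction (_ , x∈S , Joins⇒~ j) none
    ... | yes (y , y∈S , y~u) with e′ , j′ ← ~⇒Joins y~u | f′ , k′ ← ~⇒Joins (~-sym u~v) =
      t y u + s e′ f′ , λ {x} {e} {f} x∈S j k → begin
        t y u + s e′ f′               ≡⟨ cong (λ h → t y u + s e′ h) (Joins-injective k′ k) ⟩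
        t y u + s e′ f                ≈⟨ ∙-congʳ (consistent x∈S u∈S y∈S j j′) ⟩
        (t x u + s e e′) + s e′ f     ≈⟨ assoc _ _ _ ⟩
        t x u + (s e e′ + s e′ f)     ≈⟨ ∙-congˡ (s-add e e′ f (_ , j) (_ , j′) (_ , k)) ⟨
        t x u + s e f                 ∎

    c : Carrier
    c = proj₁ label-new

    -- `consistent` tests only pairs that are edges, and the only neighbour of `v` in `S` is `u`.
    -- Hence `c` can be given to all pairs `(v , y)` with `y` in place of `u`, which keeps
    -- antisymmetry valid on all pairs of vertices.
    t⁺ : Vertex → Vertex → Carrier
    t⁺ x y with x ≟ v | y ≟ v
    ... | yes _ | yes _ = 0ᴬ
    ... | yes _ | no  _ = c
    ... | no  _ | yes _ = - c
    ... | no  _ | no  _ = t x y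

    t⁺-antisym : ∀ x y → t⁺ y x ≈ - t⁺ x y
    t⁺-antisym x y with x ≟ v | y ≟ v
    ... | yes _ | yes _ = ≈-sym ε⁻¹≈ε
    ... | yes _ | no  _ = ≈-refl
    ... | no  _ | yes _ = ≈-sym (⁻¹-involutive c)
    ... | no  _ | no  _ = antisym x y

    ∈-tail : ∀ {x} → x ≢ v → x ∈ v ∷ S → x ∈ S
    ∈-tail x≢v (here x≡v)  = contradiction x≡v x≢v
    ∈-tail x≢v (there x∈S) = x∈S

    neighbour : ∀ {x} → x ∈ v ∷ S → x ~ v → x ≡ u
    neighbour x∈ x~v =
      leaf-neighbour g v∉S u∈S u~v (∈-tail (λ x≡v → ~-irrefl x≡v x~v) x∈) x~v

    t⁺-consistent : ∀ {x y z e f} → x ∈ v ∷ S → y ∈ v ∷ S → z ∈ v ∷ S →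
                    e Joins x , y → f Joins z , y → t⁺ z y ≈ t⁺ x y + s e f
    t⁺-consistent {x} {y} {z} x∈ y∈ z∈ j k with x ≟ z
    ... | yes x≡z = label-consistent-refl t⁺ x≡z j k
    ... | no  x≢z with y ≟ v
    -- The common vertex is the leaf, which carries a single edge, so two distinct edges cannot meet
    -- there.
    ...   | yes refl = contradiction
            (trans (neighbour x∈ (Joins⇒~ j)) (sym (neighbour z∈ (Joins⇒~ k)))) x≢z
    ...   | no  y≢v with x ≟ v | z ≟ v
    ...     | yes x≡v  | yes z≡v  = contradiction (trans x≡v (sym z≡v)) x≢z
    ...     | no  x≢v  | no  z≢v  =
              consistent (∈-tail x≢v x∈) (∈-tail y≢v y∈) (∈-tail z≢v z∈) j k
    -- Here `e` is the new edge and `f` an old one, so the defining equation of `c` is read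
    -- backwards.
    ...     | yes refl | no  z≢v  with refl ← neighbour y∈ (~-sym (Joins⇒~ j)) =
              s-flip (t z u) c (_ , k) (_ , j) (proj₂ label-new (∈-tail z≢v z∈) k j)
    ...     | no  x≢v  | yes refl with refl ← neighbour y∈ (~-sym (Joins⇒~ k)) =
              proj₂ label-new (∈-tail x≢v x∈) j k

    t⁺-isLabelling : IsLabelling (v ∷ S) t⁺
    t⁺-isLabelling = record { antisym = t⁺-antisym ; consistent = t⁺-consistent }

  Grown⇒labelling : ∀ {S} → Grown S → ∃[ t ] IsLabelling S t
  Grown⇒labelling (root r) = (λ _ _ → 0ᴬ) , record
    { antisym    = λ _ _ → ≈-sym ε⁻¹≈ε
    ; consistent = λ { (here refl) (here refl) (here refl) j k →
                       label-consistent-refl (λ _ _ → 0ᴬ) refl j k }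
    }
  Grown⇒labelling (leaf g u∈S v∉S u~v) =
    _ , Extend.t⁺-isLabelling g u∈S v∉S u~v (proj₂ (Grown⇒labelling g))

-- The group of order three and the powers of `γ`.

infixl 6 _+₃_
_+₃_ : Fin 3 → Fin 3 → Fin 3
x +₃ y = (toℕ x ℕ.+ toℕ y) mod 3

-- Modulo 3, negation is doubling.
-₃_ : Fin 3 → Fin 3
-₃ x = (2 ℕ.* toℕ x) mod 3

ℤ/3 : Group 0ℓ 0ℓ
ℤ/3 = record
  { Carrier = Fin 3
  ; _≈_     = _≡_
  ; _∙_     = _+₃_
  ; ε       = 0F
  ; _⁻¹     = -₃_
  ; isGroup = record
    { isMonoid = record
      { isSemigroup = record
        { isMagma = record { isEquivalence = isEquivalence ; ∙-cong = cong₂ _+₃_ }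
        ; assoc   = toWitness {a? = all? λ x → all? λ y → all? λ z →
                      (x +₃ y) +₃ z ≟ x +₃ (y +₃ z)} _
        }
      ; identity = toWitness {a? = all? λ x → 0F +₃ x ≟ x} _
                 , toWitness {a? = all? λ x → x +₃ 0F ≟ x} _
      }
    ; inverse = toWitness {a? = all? λ x → (-₃ x) +₃ x ≟ 0F} _
              , toWitness {a? = all? λ x → x +₃ (-₃ x) ≟ 0F} _
    ; ⁻¹-cong = cong -₃_
    }
  }

γ^ : Fin 3 → ℤ[γ]
γ^ 0F = 1#
γ^ 1F = γ
γ^ 2F = γ̄

-- Meaningful only on the powers of γ; the other values are junk.
log : ℤ[γ] → Fin 3
log ⟨ ℤ.+ 1 , _ ⟩ = 0F
log ⟨ ℤ.+ 0 , _ ⟩ = 1F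
log ⟨ _     , _ ⟩ = 2F

-- Since `γ` has order three, the product is 1 only if `x + y - z = 0`. Passing to `log` makes this
-- a finite check over 27 triples. The factor `1#` is the value that `walkValue` gives to the last
-- vertex.
γ^-triangle : ∀ x y z → γ^ x * (γ^ y * (γ^ (-₃ z) * 1#)) ≡ 1# → z ≡ x +₃ y
γ^-triangle x y z eq = toWitness {a? = all? λ x → all? λ y → all? λ z →
  (log (γ^ x * (γ^ y * (γ^ (-₃ z) * 1#))) ≟ 0F) →-dec (z ≟ x +₃ y)} _ x y z (cong log eq)

-- Gains: exponents of `γ` in the Hermitian adjacency matrix.

module Gain {G : Graph} (Y : MixedOrientation G) where
  open Graph G
  open MixedOrientation Y

  -- Digons and non-adjacent pairs both get `0F`. In particular the diagonal does, so an edge has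
  -- difference zero to itself.
  gain : Vertex → Vertex → Fin 3
  gain u v = if does (Arc? u v) then 1F else if does (Arc? v u) then 2F else 0F

  gain-flip : ∀ u v → gain v u ≡ -₃ gain u v
  gain-flip u v with Arc? u v | Arc? v u
  ... | yes a | yes b = ⊥-elim (Arc-asym a b)
  ... | yes _ | no  _ = refl
  ... | no  _ | yes _ = refl
  ... | no  _ | no  _ = refl

  gain-refl : ∀ u → gain u u ≡ 0F
  gain-refl u with Arc? u u
  ... | yes a = ⊥-elim (Arc-asym a a)
  ... | no  _ = refl

  Arc⇒gain : ∀ {u v} → Arc u v → gain u v ≡ 1F
  Arc⇒gain {u} {v} a rewrite dec-true (Arc? u v) a = refl

  gain⇒Arc : ∀ {u v} → gain u v ≡ 1F → Arc u v
  gain⇒Arc {u} {v} eq with Arc? u v | Arc? v u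
  ... | yes a | _     = a
  ... | no  _ | yes _ = contradiction eq λ ()
  ... | no  _ | no  _ = contradiction eq λ ()

  H≡γ^gain : ∀ {u v} → u ~ v → H Y u v ≡ γ^ (gain u v)
  H≡γ^gain {u} {v} u~v with u ~? v | Arc? u v | Arc? v u
  ... | no  u≁v | _     | _     = contradiction u~v u≁v
  ... | yes _   | yes _ | _     = refl
  ... | yes _   | no  _ | yes _ = refl
  ... | yes _   | no  _ | no  _ = refl

  -- The triangle `u`, `v`, `w` is a cycle of value 1 whose last step runs from `w` back to `u`;
  -- this is where the negated gain comes from.
  gain-triangle : IsMonograph Y → ∀ {u v w} → u ~ v → v ~ w → u ~ w →
                  gain u w ≡ gain u v +₃ gain v w
  gain-triangle mono {u} {v} {w} u~v v~w u~w =
    γ^-triangle (gain u v) (gain v w) (gain u w) (begin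
      γ^ (gain u v) * (γ^ (gain v w) * (γ^ (-₃ gain u w) * 1#))
        ≡⟨ cong (λ x → γ^ (gain u v) * (γ^ (gain v w) * (γ^ x * 1#))) (gain-flip u w) ⟨
      γ^ (gain u v) * (γ^ (gain v w) * (γ^ (gain w u) * 1#))
        ≡⟨ cong₂ (λ x y → x * (y * (γ^ (gain w u) * 1#))) (H≡γ^gain u~v) (H≡γ^gain v~w) ⟨
      H Y u v * (H Y v w * (γ^ (gain w u) * 1#))
        ≡⟨ cong (λ x → H Y u v * (H Y v w * (x * 1#))) (H≡γ^gain (~-sym u~w)) ⟨
      H Y u v * (H Y v w * (H Y w u * 1#))
        ≡⟨ mono u (v ∷ w ∷ []) triangle ⟩
      1# ∎)
    where
    open ≡-Reasoning
    ~⇒≢ : ∀ {x y} → x ~ y → x ≢ y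
    ~⇒≢ x~y x≡y = ~-irrefl x≡y x~y
    triangle : IsCycle u (v ∷ w ∷ [])
    triangle = record
      { long     = s≤s (s≤s (s≤s z≤n))
      ; distinct = (~⇒≢ u~v ∷ ~⇒≢ u~w ∷ []) ∷ (~⇒≢ v~w ∷ []) ∷ [] ∷ []
      ; walk     = u~v ∷ v~w ∷ ~-sym u~w ∷ [-]
      }

-- From a labelling to a mixed orientation and its line graph.

module FromLabelling (T : Graph) (t : Graph.Vertex T → Graph.Vertex T → Fin 3)
                     (antisym : ∀ u v → t v u ≡ -₃ t u v) where
  open Graph T
  open Edges T

  -- `t` also has values on non-adjacent pairs, hence the adjacency condition on arcs. An arc read
  -- against its direction has label `2F` by antisymmetry.
  orientation : MixedOrientation T
  orientation = record
    { Arc      = λ u v → u ~ v × t u v ≡ 1F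
    ; Arc?     = λ u v → (u ~? v) ×-dec (t u v ≟ 1F)
    ; Arc⇒~    = proj₁
    ; Arc-asym = λ {u} {v} (_ , p) (_ , q) →
        contradiction (trans (trans (sym q) (antisym u v)) (cong -₃_ p)) λ ()
    }

  open MixedOrientation orientation

  At : Fin 3 → Edge → Vertex → Set
  At 0F = DigonAt
  At 1F = HeadAt
  At 2F = TailAt

  t-flip : ∀ {u v x} → t u v ≡ x → t v u ≡ -₃ x
  t-flip {u} {v} p = trans (antisym u v) (cong -₃_ p)

  At-label : ∀ {e u v} x → t u v ≡ x → e Joins u , v → At x e v
  At-label 0F p j = _ , j , Joins⇒~ j
    , (λ (_ , q) → contradiction (trans (sym p) q) λ ())
    , (λ (_ , q) → contradiction (trans (sym (t-flip p)) q) λ ())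
  At-label 1F p j = _ , j , Joins⇒~ j , p
  At-label 2F p j = _ , j , ~-sym (Joins⇒~ j) , t-flip p

  label-At : ∀ {e u v} x → At x e v → e Joins u , v → t u v ≡ x
  label-At 1F (_ , k , _ , p) j with refl ← Joins-unique j k = p
  label-At 2F (_ , k , _ , p) j with refl ← Joins-unique j k = t-flip p
  label-At {u = u} {v} 0F (_ , k , u~v , ¬a , ¬b) j with refl ← Joins-unique j k =
    unlabelled (t u v) refl
    where
    unlabelled : ∀ x → t u v ≡ x → t u v ≡ 0F
    unlabelled 0F eq = eq
    unlabelled 1F eq = contradiction (u~v , eq) ¬a
    unlabelled 2F eq = contradiction (~-sym u~v , t-flip eq) ¬b

  -- The three rules for an arc of the line graph, head to tail, digon to head and tail to digon,
  -- are the label steps 1 to 2, 0 to 1 and 2 to 0: each adds one modulo 3.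
  LineArcAt⇒At : ∀ {v e f} → LineArcAt v e f → ∃[ x ] At x e v × At (x +₃ 1F) f v
  LineArcAt⇒At (inj₁       (h , l))  = 1F , h , l
  LineArcAt⇒At (inj₂ (inj₁ (d , h))) = 0F , d , h
  LineArcAt⇒At (inj₂ (inj₂ (l , d))) = 2F , l , d

  At⇒LineArcAt : ∀ {v e f} x → At x e v → At (x +₃ 1F) f v → LineArcAt v e f
  At⇒LineArcAt 0F d h = inj₂ (inj₁ (d , h))
  At⇒LineArcAt 1F h l = inj₁ (h , l)
  At⇒LineArcAt 2F l d = inj₂ (inj₂ (l , d))

  LineArcAt⇒label : ∀ {v e f u w} → e Joins u , v → f Joins w , v →
                    LineArcAt v e f → t w v ≡ t u v +₃ 1F
  LineArcAt⇒label j k a with x , p , q ← LineArcAt⇒At a =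
    trans (label-At (x +₃ 1F) q k) (cong (_+₃ 1F) (sym (label-At x p j)))

  label⇒LineArcAt : ∀ {v e f u w} → e Joins u , v → f Joins w , v →
                    t w v ≡ t u v +₃ 1F → LineArcAt v e f
  label⇒LineArcAt {v} {u = u} j k eq =
    At⇒LineArcAt (t u v) (At-label (t u v) refl j) (At-label (t u v +₃ 1F) eq k)

-- Transport along the isomorphism and conclusion.

theorem32 : (G : Graph) (Y : MixedOrientation G) → IsMonograph Y →
    (T : Graph) → Graph.IsTree T → (φ : G ≅ lineGraph T) →
    Σ[ X ∈ MixedOrientation T ] EqualAlong φ Y (lineγ X)
theorem32 G Y mono T tree φ = orientation , λ a b → mk⇔ (arc⇒ a b) (arc⇐ a b)
  where
  open Graph T
  open IsTree tree
  open Growth T acyclic using (Grown; spanning-growth)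
  open Gain Y
  open Group ℤ/3 using (identityˡ; identityʳ; inverseʳ)
  open GroupProperties ℤ/3 using (∙-cancelˡ)
  open _≅_ φ using (to; adjacency)
  module φ = Inverse (_≅_.bijection φ)
  module G = Graph G
  module Y = MixedOrientation Y

  from : Edge → G.Vertex
  from = φ.from

  to-from : ∀ e → to (from e) ≡ e
  to-from e = φ.inverseˡ refl

  from-to : ∀ a → from (to a) ≡ a
  from-to a = φ.inverseʳ refl

  s : Edge → Edge → Fin 3
  s e f = gain (from e) (from f)

  from-~ : ∀ {v e f} → e ≢ f → v ∈ᵉ e → v ∈ᵉ f → from e G.~ from f
  from-~ {v} {e} {f} e≢f ve vf = Equivalence.from (adjacency (from e) (from f))
    (subst₂ (Graph._~_ (lineGraph T)) (sym (to-from e)) (sym (to-from f)) (e≢f , v , ve , vf))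

  -- Three distinct edges at `v` form a triangle of the line graph, where the monograph condition
  -- applies. Coinciding edges form no cycle and are settled by `gain-refl` and `gain-flip`.
  s-add : ∀ {v} e f g → v ∈ᵉ e → v ∈ᵉ f → v ∈ᵉ g → s e g ≡ s e f +₃ s f g
  s-add e f g ve vf vg with e ≟ f | f ≟ g | e ≟ g
  ... | yes refl | _ | _ =
    sym (trans (cong (_+₃ s e g) (gain-refl (from e))) (identityˡ (s e g)))
  ... | no _ | yes refl | _ =
    sym (trans (cong (s e f +₃_) (gain-refl (from f))) (identityʳ (s e f)))
  ... | no _ | no _ | yes refl =
    trans (gain-refl (from e)) (sym (trans (cong (s e f +₃_) (gain-flip (from e) (from f)))
      (inverseʳ (s e f))))
  ... | no e≢f | no f≢g | no e≢g =
    gain-triangle mono (from-~ e≢f ve vf) (from-~ f≢g vf vg) (from-~ e≢g ve vg)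

  open Labelling ℤ/3 T acyclic s (λ e → gain-refl (from e)) s-add

  root-vertex : Vertex
  root-vertex = fromℕ< (ℕ.>-nonZero⁻¹ order {{nonempty}})

  growth : ∃[ S ] Grown S × (∀ v → v ∈ S)
  growth = spanning-growth root-vertex connected

  ∈S : ∀ v → v ∈ proj₁ growth
  ∈S = proj₂ (proj₂ growth)

  labelling : ∃[ t ] IsLabelling (proj₁ growth) t
  labelling = Grown⇒labelling (proj₁ (proj₂ growth))

  t : Vertex → Vertex → Fin 3
  t = proj₁ labelling
  open IsLabelling (proj₂ labelling)

  open FromLabelling T t antisym

  t-consistent : ∀ {u v w} a b → to a Joins u , v → to b Joins w , v →
                 t w v ≡ t u v +₃ gain a b
  t-consistent {u} {v} {w} a b j k =
    trans (consistent (∈S u) (∈S v) (∈S w) j k)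
          (cong (t u v +₃_) (cong₂ gain (from-to a) (from-to b)))

  arc⇒ : ∀ a b → Y.Arc a b → MixedOrientation.Arc (lineγ orientation) (to a) (to b)
  arc⇒ a b arc
    with e≢f , v , (u , j) , (w , k) ← Equivalence.to (adjacency a b) (Y.Arc⇒~ arc) =
    e≢f , v , label⇒LineArcAt j k
      (trans (t-consistent a b j k) (cong (t u v +₃_) (Arc⇒gain arc)))

  arc⇐ : ∀ a b → MixedOrientation.Arc (lineγ orientation) (to a) (to b) → Y.Arc a b
  arc⇐ a b (_ , v , arc)
    with (u , j) , (w , k) ← MixedOrientation.LineArcAt⇒∈ orientation arc =
    -- The label `t w v` equals both `t u v + gain a b` and `t u v + 1`, so cancelling `t u v`
    -- leaves gain 1.
    gain⇒Arc (∙-cancelˡ (t u v) (gain a b) 1F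
      (trans (sym (t-consistent a b j k)) (LineArcAt⇒label j k arc)))
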